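{- Let $\alpha>\beta$ be positive integers, let $k\geq 2$, and let $n_1,\dots,n_k$ be integers with $n_1,n_2\geq 2\alpha+1$ and $n_3,\dots,n_k\geq \alpha+\beta-1$. If an $(\alpha,\beta)$-tour on the $n_1\times n_2$ chessboard exists, then an $(\alpha,\beta)$-tour on the $n_1\times n_2\times\cdots\times n_k$ chessboard exists.
   Context: The $n_1\times\cdots\times n_d$ chessboard is $\{1,\dots,n_1\}\times\cdots\times\{1,\dots,n_d\}\subset\mathbb{Z}^d$. An $(\alpha,\beta)$-move is a vector in $\mathbb{Z}^d$ with exactly $d-2$ coordinates equal to $0$, exactly one coordinate in $\{\pm\alpha\}$ and exactly one coordinate in $\{\pm\beta\}$. Two cells are adjacent iff their difference is an $(\alpha,\beta)$-move. An $(\alpha,\beta)$-tour is a Hamiltonian cycle in this graph. -}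

module Defs where

open import Data.Integer using (ℤ; +_; -_; _-_; 0ℤ; 1ℤ) renaming (_≤_ to _≤ℤ_)
open import Data.Integer.Properties using (_≟_)
open import Data.List using (List; _∷_; _∷ʳ_; length)
open import Data.List.Membership.Propositional using (_∈_)
open import Data.List.Relation.Unary.Linked using (Linked)
open import Data.List.Relation.Unary.Unique.Propositional using (Unique)
open import Data.Nat using (ℕ; _+_; _≥_)
open import Data.Product using (_×_)
open import Data.Sum using (_⊎_)
open import Data.Vec using (Vec; count; zipWith)
open import Data.Vec.Relation.Binary.Pointwise.Inductive using (Pointwise)
open import Function.Bundles using (_⇔_)
open import Level using (0ℓ)
open import Relation.Binary.Core using (Rel)
open import Relation.Binary.PropositionalEquality using (_≡_)
open import Relation.Nullary.Decidable using (_⊎-dec_)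
open import Relation.Unary using (Pred; Decidable)

-- A Hamiltonian cycle of the graph with vertex set V ⊆ A and adjacency E.
-- It is presented from a starting vertex; the closing edge, from the last
-- vertex back to the first, is the final link of `linked`.
record HamiltonianCycle {A : Set} (V : Pred A 0ℓ) (E : Rel A 0ℓ) : Set where
  field
    start  : A
    rest   : List A
    long   : length (start ∷ rest) ≥ 3
    unique : Unique (start ∷ rest)
    spans  : ∀ v → v ∈ (start ∷ rest) ⇔ V v
    linked : Linked E (start ∷ (rest ∷ʳ start))

Chessboard : ∀ {d} → Vec ℕ d → Pred (Vec ℤ d) 0ℓ
Chessboard ns v = Pointwise (λ n x → (1ℤ ≤ℤ x) × (x ≤ℤ + n)) ns v

Is± : ℕ → Pred ℤ 0ℓ
Is± a x = (x ≡ + a) ⊎ (x ≡ - (+ a))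

is±? : ∀ a → Decidable (Is± a)
is±? a x = (x ≟ + a) ⊎-dec (x ≟ - (+ a))

record IsMove (α β : ℕ) {d : ℕ} (v : Vec ℤ d) : Set where
  field
    -- d - 2 zero coordinates, stated without truncated subtraction
    zeros : count (_≟ 0ℤ) v + 2 ≡ d
    one-α : count (is±? α) v ≡ 1
    one-β : count (is±? β) v ≡ 1

Adjacent : (α β : ℕ) → ∀ {d} → Rel (Vec ℤ d) 0ℓ
Adjacent α β u v = IsMove α β (zipWith _-_ v u)

Tour : (α β : ℕ) → ∀ {d} → Vec ℕ d → Set
Tour α β ns = HamiltonianCycle (Chessboard ns) (Adjacent α β)

{-# OPTIONS --safe #-}
module Submission where

-- Two tours in parallel layers at distance a merge into one when the first contains an
-- edge uv and the second an edge u′v′ such that u, u′ and v, v′ differ by ±b in one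
-- coordinate, where {a , b} = {α , β}: replace uv and u′v′ by uu′ and vv′.
--
-- In the plane such pairs occur in a single tour at every corner.  The corner cell has
-- only two neighbours, so both edges there are forced.  The cell at distance b from the
-- corner along the side keeps an edge to a neighbour other than (1 + b , 1 + b - a), and
-- this edge pairs with one of the forced ones.  The two corners on one side of the board
-- give a pair for b = β and a pair for b = α, the opposite side gives a spare copy of
-- each, and n₁ , n₂ ≥ 2α + 1 makes the eight edges distinct.
--
-- A planar tour forces α and β to be coprime, so the graph on 1, …, n with differences α
-- and β is connected for n ≥ α + β - 1.  Copies of the tour are merged along a spanning
-- tree of this graph.  The spare pairs survive in layers 1 and 2 and carry the induction
-- on the dimension.

open import Defs
import Algebra.Properties.AbelianGroup
open import Data.Bool using (Bool; true; false; not; if_then_else_)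
open import Data.Bool.Properties using (¬-not; not-involutive) renaming (_≟_ to _≟ᵇ_)
open import Data.Empty using (⊥; ⊥-elim)
open import Data.Integer as ℤ using (ℤ; +_; 0ℤ; 1ℤ; ∣_∣; +≤+)
import Data.Integer.Divisibility.Signed as ℤ∣
import Data.Integer.Properties as ℤ
open import Data.Integer.Tactic.RingSolver using (solve-∀)
open import Data.List using (List; []; _∷_; _++_; _∷ʳ_; length)
import Data.List as List
open import Data.List.Membership.Propositional using (_∈_; _∉_)
open import Data.List.Membership.Propositional.Properties
  using (∈-++⁺ˡ; ∈-++⁺ʳ; ∈-++⁻; ∈-map⁺; ∈-map⁻)
open import Data.List.Properties using (length-++; length-map)
open import Data.List.Relation.Binary.Permutation.Propositional
  using (_↭_; ↭-refl; ↭-sym; ↭-trans; ↭-reflexive; ↭⇒↭ₛ)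
open import Data.List.Relation.Binary.Permutation.Propositional.Properties
  using (∈-resp-↭; ↭-length; ++-comm; ++⁺ʳ)
open import Data.List.Relation.Binary.Permutation.Setoid.Properties using (Unique-resp-↭)
import Data.List.Relation.Unary.All as ListAll
open import Data.List.Relation.Unary.All using ([]; _∷_)
open import Data.List.Relation.Unary.AllPairs using (_∷_)
open import Data.List.Relation.Unary.Any using (here; there)
open import Data.List.Relation.Unary.Linked using (Linked; [-]; _∷_)
open import Data.List.Relation.Unary.Unique.Propositional using (Unique)
import Data.List.Relation.Unary.Unique.Propositional.Properties as Unique
open import Data.Nat using (ℕ; zero; suc; _+_; _*_; _∸_; _≤_; _<_; _>_; _≥_; z≤n; s≤s; _≟_; _<?_)
open import Data.List.Membership.DecPropositional _≟_ using (_∈?_)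
open import Data.Nat.Coprimality as Coprime using (Coprime; coprime-+; coprime-Bézout)
import Data.Nat.Divisibility as ℕ∣
open import Data.Nat.DivMod using (_%_; [m+kn]%n≡m%n; m<n⇒m%n≡m)
open import Data.Nat.GCD using (module Bézout)
open import Data.Nat.Induction using (<-rec)
open import Data.Nat.Properties hiding (_≟_; _<?_)
import Data.Nat.Tactic.RingSolver as ℕ-Ring
open import Data.Product using (Σ; ∃; ∃₂; _×_; _,_; proj₁; proj₂; map₁; map₂)
open import Data.Sum as Sum using (_⊎_; inj₁; inj₂)
open import Data.Vec using (Vec; []; _∷_; head; tail; count; zipWith)
open import Data.Vec.Relation.Binary.Pointwise.Inductive using ([]; _∷_)
open import Data.Vec.Relation.Unary.All using (All; []; _∷_)
open import Function using (_∘_; id)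
open import Function.Bundles using (_⇔_; mk⇔; Equivalence)
open import Level using (0ℓ)
open import Relation.Binary.Construct.Closure.ReflexiveTransitive using (Star; ε; _◅_; _◅◅_)
open import Relation.Binary.Core using (Rel)
open import Relation.Binary.Definitions using (Symmetric)
open import Relation.Binary.PropositionalEquality
  using (_≡_; _≢_; refl; sym; trans; cong; subst; setoid)
open import Relation.Nullary using (¬_; yes; no; does)
open import Relation.Unary using (Pred; Decidable)

private module ℤ-Group = Algebra.Properties.AbelianGroup ℤ.+-0-abelianGroup

-- Cyclic paths

private variable
  A B : Set
  a b c d w x y z : A

infixr 5 _∷_ _⧺_

-- A bare nonempty sequence: adjacency is imposed only later, by `IsCycle`, so that paths can be
-- cut, reversed and glued freely. The end vertices are in the type because they determine the
-- closing edge.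
data Path {A : Set} : A → A → Set where
  [_] : ∀ x → Path x x
  _∷_ : ∀ x {y z} → Path y z → Path x z

vertices : Path {A} x y → List A
vertices [ x ]   = x ∷ []
vertices (x ∷ p) = x ∷ vertices p

Link : A → A → Rel A 0ℓ
Link a b x y = (a ≡ x × b ≡ y) ⊎ (a ≡ y × b ≡ x)

Step : A → A → Path {A} x y → Set
Step a b [ _ ]           = ⊥
Step a b (_∷_ x {y} p) = Link a b x y ⊎ Step a b p

-- A path also stands for the cyclic order that returns from its last vertex to its first.
Edge : A → A → Path {A} x y → Set
Edge {x = x} {y} a b p = Link a b x y ⊎ Step a b p

link-swapʳ : Link a b x y → Link a b y x
link-swapʳ (inj₁ e) = inj₂ e
link-swapʳ (inj₂ e) = inj₁ e

link-swapˡ : Link a b x y → Link b a x y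
link-swapˡ (inj₁ (p , q)) = inj₂ (q , p)
link-swapˡ (inj₂ (p , q)) = inj₁ (q , p)

step-swap : (p : Path {A} x y) → Step a b p → Step b a p
step-swap (_ ∷ p) (inj₁ l) = inj₁ (link-swapˡ l)
step-swap (_ ∷ p) (inj₂ s) = inj₂ (step-swap p s)

edge-swap : (p : Path {A} x y) → Edge a b p → Edge b a p
edge-swap p = Sum.map link-swapˡ (step-swap p)

-- The two paths share no end: a new step leads from `x` to `y`. Read cyclically, the closing edges
-- `wx` and `yz` give way to `xy` and `zw`.
_⧺_ : Path {A} w x → Path y z → Path w z
[ w ]   ⧺ q = w ∷ q
(w ∷ p) ⧺ q = w ∷ (p ⧺ q)

vertices-⧺ : (p : Path {A} w x) (q : Path y z) → vertices (p ⧺ q) ≡ vertices p ++ vertices q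
vertices-⧺ [ w ]   q = refl
vertices-⧺ (w ∷ p) q = cong (w ∷_) (vertices-⧺ p q)

Step-⧺ : ∀ {w x y z : A} → A → A → Path w x → Path y z → Set
Step-⧺ {x = x} {y} a b p q = Step a b p ⊎ Link a b x y ⊎ Step a b q

step-⧺⁻ : (p : Path {A} w x) (q : Path y z) → Step a b (p ⧺ q) → Step-⧺ a b p q
step-⧺⁻ [ w ]   q s        = inj₂ s
step-⧺⁻ (w ∷ p) q (inj₂ s) = Sum.map inj₂ id (step-⧺⁻ p q s)
step-⧺⁻ (w ∷ [ _ ])   q (inj₁ l) = inj₁ (inj₁ l)
step-⧺⁻ (w ∷ (_ ∷ _)) q (inj₁ l) = inj₁ (inj₁ l)

step-⧺⁺ : (p : Path {A} w x) (q : Path y z) → Step-⧺ a b p q → Step a b (p ⧺ q)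
step-⧺⁺ [ w ]         q (inj₂ s)        = s
step-⧺⁺ (w ∷ p)       q (inj₂ s)        = inj₂ (step-⧺⁺ p q (inj₂ s))
step-⧺⁺ (w ∷ p)       q (inj₁ (inj₂ s)) = inj₂ (step-⧺⁺ p q (inj₁ s))
step-⧺⁺ (w ∷ [ _ ])   q (inj₁ (inj₁ l)) = inj₁ l
step-⧺⁺ (w ∷ (_ ∷ _)) q (inj₁ (inj₁ l)) = inj₁ l

reverse : Path {A} x y → Path y x
reverse [ x ]   = [ x ]
reverse (x ∷ p) = reverse p ⧺ [ x ]

vertices-reverse : (p : Path {A} x y) → vertices (reverse p) ↭ vertices p
vertices-reverse [ x ]   = ↭-refl
vertices-reverse (x ∷ p) = ↭-trans (↭-reflexive (vertices-⧺ (reverse p) [ x ]))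
  (↭-trans (++⁺ʳ (x ∷ []) (vertices-reverse p)) (++-comm (vertices p) (x ∷ [])))

step-reverse⁺ : (p : Path {A} x y) → Step a b p → Step a b (reverse p)
step-reverse⁺ (x ∷ p) (inj₁ l) = step-⧺⁺ (reverse p) [ x ] (inj₂ (inj₁ (link-swapʳ l)))
step-reverse⁺ (x ∷ p) (inj₂ s) = step-⧺⁺ (reverse p) [ x ] (inj₁ (step-reverse⁺ p s))

step-reverse⁻ : (p : Path {A} x y) → Step a b (reverse p) → Step a b p
step-reverse⁻ (x ∷ p) s with step-⧺⁻ (reverse p) [ x ] s
... | inj₁ s′        = inj₂ (step-reverse⁻ p s′)
... | inj₂ (inj₁ l) = inj₁ (link-swapʳ l)

infix 4 _≃_

-- Equality of the undirected cycles carried by two paths; rotation and reversal preserve it, and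
-- `IsCycle` depends on nothing else.
record _≃_ {A : Set} {w x y z : A} (p : Path w x) (q : Path y z) : Set where
  field
    vertices-↭ : vertices p ↭ vertices q
    edges⁺     : ∀ {a b} → Edge a b p → Edge a b q
    edges⁻     : ∀ {a b} → Edge a b q → Edge a b p

open _≃_

≃-refl : {p : Path {A} x y} → p ≃ p
≃-refl = record { vertices-↭ = ↭-refl ; edges⁺ = id ; edges⁻ = id }

≃-trans : {p : Path {A} a b} {q : Path c d} {r : Path x y} → p ≃ q → q ≃ r → p ≃ r
≃-trans e f = record
  { vertices-↭ = ↭-trans (vertices-↭ e) (vertices-↭ f)
  ; edges⁺ = edges⁺ f ∘ edges⁺ e
  ; edges⁻ = edges⁻ e ∘ edges⁻ f
  }

reverse-≃ : (p : Path {A} x y) → reverse p ≃ p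
reverse-≃ p = record
  { vertices-↭ = vertices-reverse p
  ; edges⁺ = Sum.map link-swapʳ (step-reverse⁻ p)
  ; edges⁻ = Sum.map link-swapʳ (step-reverse⁺ p)
  }

-- The closing edge of one order is the joining step of the other.
rotate-edges : (p : Path {A} w x) (q : Path y z) → Edge a b (p ⧺ q) → Edge a b (q ⧺ p)
rotate-edges p q (inj₁ l) = inj₂ (step-⧺⁺ q p (inj₂ (inj₁ (link-swapʳ l))))
rotate-edges p q (inj₂ s) with step-⧺⁻ p q s
... | inj₁ s′        = inj₂ (step-⧺⁺ q p (inj₂ (inj₂ s′)))
... | inj₂ (inj₁ l)  = inj₁ (link-swapʳ l)
... | inj₂ (inj₂ s′) = inj₂ (step-⧺⁺ q p (inj₁ s′))

rotate-≃ : (p : Path {A} w x) (q : Path y z) → q ⧺ p ≃ p ⧺ q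
rotate-≃ p q = record
  { vertices-↭ = ↭-trans (↭-reflexive (vertices-⧺ q p))
      (↭-trans (++-comm (vertices q) (vertices p)) (↭-reflexive (sym (vertices-⧺ p q))))
  ; edges⁺ = rotate-edges q p
  ; edges⁻ = rotate-edges p q
  }

data Split {A : Set} {x y : A} (a b : A) : Path x y → Set where
  split : ∀ {c d} (p : Path x c) (q : Path d y) → Link a b c d → Split a b (p ⧺ q)

split-step : (p : Path {A} x y) → Step a b p → Split a b p
split-step (x ∷ p) (inj₁ l) = split [ x ] p l
split-step (x ∷ p) (inj₂ s) with split-step p s
... | split p₁ p₂ l = split (x ∷ p₁) p₂ l

orient : (p : Path {A} x y) → Link a b x y → Σ (Path a b) (_≃ p)
orient p (inj₁ (refl , refl)) = p , ≃-refl
orient p (inj₂ (refl , refl)) = reverse p , reverse-≃ p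

-- Makes a chosen edge the closing one, which is the edge that a later concatenation deletes.
open-at : (p : Path {A} x y) → Edge a b p → Σ (Path a b) (_≃ p)
open-at p (inj₁ l) = orient p l
open-at p (inj₂ s) with split-step p s
... | split p₁ p₂ l with orient (p₂ ⧺ p₁) (link-swapʳ l)
...   | q , e = q , ≃-trans e (rotate-≃ p₁ p₂)

head∈ : (p : Path {A} x y) → x ∈ vertices p
head∈ [ x ]   = here refl
head∈ (x ∷ p) = here refl

last∈ : (p : Path {A} x y) → y ∈ vertices p
last∈ [ x ]   = here refl
last∈ (x ∷ p) = there (last∈ p)

step⇒∈ˡ : (p : Path {A} x y) → Step a b p → a ∈ vertices p
step⇒∈ˡ (x ∷ p) (inj₁ (inj₁ (refl , _))) = here refl
step⇒∈ˡ (x ∷ p) (inj₁ (inj₂ (refl , _))) = there (head∈ p)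
step⇒∈ˡ (x ∷ p) (inj₂ s)                 = there (step⇒∈ˡ p s)

edge⇒∈ˡ : (p : Path {A} x y) → Edge a b p → a ∈ vertices p
edge⇒∈ˡ p (inj₁ (inj₁ (refl , _))) = head∈ p
edge⇒∈ˡ p (inj₁ (inj₂ (refl , _))) = last∈ p
edge⇒∈ˡ p (inj₂ s)                 = step⇒∈ˡ p s

edge⇒∈ʳ : (p : Path {A} x y) → Edge a b p → b ∈ vertices p
edge⇒∈ʳ p e = edge⇒∈ˡ p (edge-swap p e)

start-at : (p : Path {A} x y) → a ∈ vertices p → ∃ λ z → Σ (Path a z) (_≃ p)
start-at p@([ _ ])        (here refl) = _ , p , ≃-refl
start-at p@(_ ∷ _)        (here refl) = _ , p , ≃-refl
start-at {a = a} (x ∷ p) (there a∈) = go [ x ] p a∈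
  where
  go : ∀ {x c d y} (p : Path x c) (q : Path d y) → a ∈ vertices q → ∃ λ z → Σ (Path a z) (_≃ p ⧺ q)
  go p q@([ _ ]) (here refl) = _ , q ⧺ p , rotate-≃ p q
  go p q@(_ ∷ _) (here refl) = _ , q ⧺ p , rotate-≃ p q
  go p (y ∷ q)   (there a∈) with go (p ⧺ [ y ]) q a∈
  ... | _ , r , e = _ , r , subst (r ≃_) (⧺-assoc p) e
    where
    ⧺-assoc : ∀ {w x} (p : Path w x) → (p ⧺ [ y ]) ⧺ q ≡ p ⧺ (y ∷ q)
    ⧺-assoc [ x ]   = refl
    ⧺-assoc (x ∷ p) = cong (x ∷_) (⧺-assoc p)

map : (f : A → B) → Path x y → Path (f x) (f y)
map f [ x ]   = [ f x ]
map f (x ∷ p) = f x ∷ map f p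

vertices-map : (f : A → B) (p : Path x y) → vertices (map f p) ≡ List.map f (vertices p)
vertices-map f [ x ]   = refl
vertices-map f (x ∷ p) = cong (f x ∷_) (vertices-map f p)

link-map : (f : A → B) → Link a b x y → Link (f a) (f b) (f x) (f y)
link-map f (inj₁ (refl , refl)) = inj₁ (refl , refl)
link-map f (inj₂ (refl , refl)) = inj₂ (refl , refl)

edge-map⁺ : (f : A → B) (p : Path x y) → Edge a b p → Edge (f a) (f b) (map f p)
edge-map⁺ f p = Sum.map (link-map f) (step-map⁺ p)
  where
  step-map⁺ : ∀ {x y} (p : Path x y) → Step a b p → Step (f a) (f b) (map f p)
  step-map⁺ (x ∷ p) = Sum.map (link-map f) (step-map⁺ p)

edge-map⁻ : (f : A → B) (p : Path x y) {c d : B} → Edge c d (map f p) →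
  ∃₂ λ a b → Edge a b p × c ≡ f a × d ≡ f b
edge-map⁻ f p {c} {d} = go
  where
  link : ∀ {x y} → Link c d (f x) (f y) → ∃₂ λ a b → Link a b x y × c ≡ f a × d ≡ f b
  link (inj₁ (e , e′)) = _ , _ , inj₁ (refl , refl) , e , e′
  link (inj₂ (e , e′)) = _ , _ , inj₂ (refl , refl) , e , e′
  step : ∀ {x y} (p : Path x y) → Step c d (map f p) → ∃₂ λ a b → Step a b p × c ≡ f a × d ≡ f b
  step (x ∷ p) (inj₁ l) = let _ , _ , l′ , e = link l in _ , _ , inj₁ l′ , e
  step (x ∷ p) (inj₂ s) = let _ , _ , s′ , e = step p s in _ , _ , inj₂ s′ , e
  go : Edge c d (map f p) → ∃₂ λ a b → Edge a b p × c ≡ f a × d ≡ f b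
  go (inj₁ l) = let _ , _ , l′ , e = link l in _ , _ , inj₁ l′ , e
  go (inj₂ s) = let _ , _ , s′ , e = step p s in _ , _ , inj₂ s′ , e

-- Hamiltonian cycles as cyclic paths

record IsCycle {A : Set} (V : Pred A 0ℓ) (E : Rel A 0ℓ) {x y : A} (p : Path x y) : Set where
  field
    long     : length (vertices p) ≥ 3
    unique   : Unique (vertices p)
    spans    : ∀ v → v ∈ vertices p ⇔ V v
    adjacent : ∀ {a b} → Edge a b p → E a b

  sound : ∀ {v} → v ∈ vertices p → V v
  sound {v} = Equivalence.to (spans v)

  complete : ∀ {v} → V v → v ∈ vertices p
  complete {v} = Equivalence.from (spans v)

open IsCycle

isCycle-resp-≃ : {V : Pred A 0ℓ} {E : Rel A 0ℓ} {p : Path w x} {q : Path y z} →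
  q ≃ p → IsCycle V E p → IsCycle V E q
isCycle-resp-≃ {A = A} e C = record
  { long     = ≤-trans (long C) (≤-reflexive (sym (↭-length (vertices-↭ e))))
  ; unique   = Unique-resp-↭ (setoid A) (↭⇒↭ₛ (↭-sym (vertices-↭ e))) (unique C)
  ; spans    = λ v → mk⇔ (sound C ∘ ∈-resp-↭ (vertices-↭ e)) (∈-resp-↭ (↭-sym (vertices-↭ e)) ∘ complete C)
  ; adjacent = adjacent C ∘ edges⁺ e
  }

-- Once the cycle starts at `c`, the neighbours are its second and its last vertex; they differ
-- because there are at least three vertices, without repetition.
two-neighbours : {V : Pred A 0ℓ} {E : Rel A 0ℓ} {p : Path x y} → IsCycle V E p → V c →
  ∃₂ λ a b → a ≢ b × Edge c a p × Edge c b p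
two-neighbours {p = p} C c∈V with start-at p (complete C c∈V)
... | z , q , e = go q (isCycle-resp-≃ e C) (edges⁺ e)
  where
  go : ∀ {V E c z} (q : Path c z) → IsCycle V E q →
    (∀ {a b} → Edge a b q → Edge a b p) → ∃₂ λ a b → a ≢ b × Edge c a p × Edge c b p
  go [ _ ]       C f with long C
  ... | s≤s ()
  go (_ ∷ [ _ ]) C f with long C
  ... | s≤s (s≤s ())
  go (_ ∷ (_ ∷ q)) C f with unique C
  ... | _ ∷ (≢s ∷ _) = _ , _ , ListAll.lookup ≢s (last∈ q)
      , f (inj₂ (inj₁ (inj₁ (refl , refl)))) , f (inj₁ (inj₁ (refl , refl)))

-- The exchange that merges two tours: only the edges `xy` and `zw` are new, and every other edge is
-- a step of `p` or of `q`.
cycle-⧺ : {U V : Pred A 0ℓ} {E : Rel A 0ℓ} (p : Path w x) (q : Path y z) → Symmetric E →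
  IsCycle U E p → IsCycle V E q → (∀ {v} → U v → ¬ V v) → E x y → E z w →
  IsCycle (λ v → U v ⊎ V v) E (p ⧺ q)
cycle-⧺ {w = w} {x} {y} {z} {U} {V} {E} p q E-sym C D disjoint xy zw = record
  { long     = ≤-trans (long C) (≤-trans (m≤m+n _ (length (vertices q)))
                 (≤-reflexive (sym (trans (cong length (vertices-⧺ p q)) (length-++ (vertices p))))))
  ; unique   = subst Unique (sym (vertices-⧺ p q))
                 (Unique.++⁺ (unique C) (unique D) λ (v∈p , v∈q) → disjoint (sound C v∈p) (sound D v∈q))
  ; spans    = λ v → mk⇔
                 (Sum.map (sound C) (sound D) ∘ ∈-++⁻ (vertices p) ∘ subst (v ∈_) (vertices-⧺ p q))
                 (subst (v ∈_) (sym (vertices-⧺ p q))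
                   ∘ Sum.[ ∈-++⁺ˡ ∘ complete C , ∈-++⁺ʳ (vertices p) ∘ complete D ])
  ; adjacent = adj
  }
  where
  via-link : ∀ {a b u v} → E u v → Link a b u v → E a b
  via-link e (inj₁ (refl , refl)) = e
  via-link e (inj₂ (refl , refl)) = E-sym e
  adj : ∀ {a b} → Edge a b (p ⧺ q) → E a b
  adj (inj₁ l) = via-link zw (link-swapʳ l)
  adj (inj₂ s) with step-⧺⁻ p q s
  ... | inj₁ s′        = adjacent C (inj₂ s′)
  ... | inj₂ (inj₁ l)  = via-link xy l
  ... | inj₂ (inj₂ s′) = adjacent D (inj₂ s′)

fromList : ∀ (x : A) xs → ∃ λ y → Σ (Path x y) λ p → vertices p ≡ x ∷ xs
fromList x []       = _ , [ x ] , refl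
fromList x (y ∷ xs) with fromList y xs
... | _ , p , e = _ , x ∷ p , cong (x ∷_) e

linked⇒adjacent : {E : Rel A 0ℓ} → Symmetric E → (p : Path x y) → Linked E (vertices p ∷ʳ c) →
  (∀ {a b} → Step a b p → E a b) × E y c
linked⇒adjacent E-sym [ x ] (e ∷ _) = (λ ()) , e
linked⇒adjacent {A} {c = c} {E = E} E-sym (x ∷ p) es = go p es
  where
  go : ∀ {z y} (p : Path z y) → Linked E (x ∷ (vertices p ∷ʳ c)) →
    (∀ {a b} → Link a b x z ⊎ Step a b p → E a b) × E y c
  extend : ∀ {z y} (p : Path z y) → E x z → Linked E (vertices p ∷ʳ c) →
    (∀ {a b} → Link a b x z ⊎ Step a b p → E a b) × E y c
  extend p e es with linked⇒adjacent E-sym p es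
  ... | steps , last = (λ { (inj₁ (inj₁ (refl , refl))) → e
                          ; (inj₁ (inj₂ (refl , refl))) → E-sym e
                          ; (inj₂ s) → steps s }) , last
  go p@([ _ ]) (e ∷ es) = extend p e es
  go p@(_ ∷ _) (e ∷ es) = extend p e es

adjacent⇒linked : {E : Rel A 0ℓ} (p : Path x y) → (∀ {a b} → Step a b p → E a b) → E y c →
  Linked E (vertices p ∷ʳ c)
adjacent⇒linked [ x ] steps e = e ∷ [-]
adjacent⇒linked (x ∷ p@([ _ ])) steps e = steps (inj₁ (inj₁ (refl , refl))) ∷ adjacent⇒linked p (λ ()) e
adjacent⇒linked (x ∷ p@(_ ∷ _)) steps e = steps (inj₁ (inj₁ (refl , refl))) ∷ adjacent⇒linked p (steps ∘ inj₂) e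

fromHamiltonian : {V : Pred A 0ℓ} {E : Rel A 0ℓ} → Symmetric E → HamiltonianCycle V E →
  ∃₂ λ x y → Σ (Path x y) (IsCycle V E)
fromHamiltonian {E = E} E-sym H with fromList start rest
  where open HamiltonianCycle H
... | y , p , e = start , y , p , record
  { long     = subst (λ xs → length xs ≥ 3) (sym e) H.long
  ; unique   = subst Unique (sym e) H.unique
  ; spans    = λ v → subst (λ xs → v ∈ xs ⇔ _) (sym e) (H.spans v)
  ; adjacent = adj
  }
  where
  module H = HamiltonianCycle H
  open H using (start)
  steps : (∀ {a b} → Step a b p → E a b) × E y start
  steps = linked⇒adjacent E-sym p (subst (λ xs → Linked E (xs ∷ʳ start)) (sym e) H.linked)
  adj : ∀ {a b} → Edge a b p → E a b
  adj (inj₁ (inj₁ (refl , refl))) = E-sym (proj₂ steps)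
  adj (inj₁ (inj₂ (refl , refl))) = proj₂ steps
  adj (inj₂ s)                    = proj₁ steps s

toHamiltonian : {V : Pred A 0ℓ} {E : Rel A 0ℓ} {p : Path x y} → IsCycle V E p → HamiltonianCycle V E
toHamiltonian {p = [ x ]} C with long C
... | s≤s ()
toHamiltonian {p = x ∷ p} C = record
  { start  = x
  ; rest   = vertices p
  ; long   = long C
  ; unique = unique C
  ; spans  = spans C
  ; linked = adjacent⇒linked (x ∷ p) (adjacent C ∘ inj₂) (adjacent C (inj₁ (inj₂ (refl , refl))))
  }

isCycle-resp-⇔ : ∀ {A : Set} {U V : Pred A 0ℓ} {E : Rel A 0ℓ} {x y} {p : Path x y} →
  (∀ v → U v ⇔ V v) → IsCycle U E p → IsCycle V E p
isCycle-resp-⇔ e C = record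
  { long     = long C
  ; unique   = unique C
  ; spans    = λ v → mk⇔ (Equivalence.to (e v) ∘ sound C) (complete C ∘ Equivalence.from (e v))
  ; adjacent = adjacent C
  }

-- Stacking copies of a cycle

InRange : ℕ → Pred ℕ 0ℓ
InRange n i = 1 ≤ i × i ≤ n

-- The second Bool is the direction of the step.
Next : (Bool → ℕ) → Bool → Bool → Rel ℕ 0ℓ
Next gap t true  i j = j ≡ i + gap t
Next gap t false i j = i ≡ j + gap t

next-swap : ∀ gap t s {i j} → Next gap t s i j → Next gap t (not s) j i
next-swap gap t true  e = e
next-swap gap t false e = e

next-functional : ∀ gap t s {i j k} → Next gap t s i j → Next gap t s i k → j ≡ k
next-functional gap t true  refl refl = refl
next-functional gap t false e    e′   = +-cancelʳ-≡ (gap t) _ _ (trans (sym e) e′)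

-- Only the target is tested, since walks start from a layer already known to be in range.
Hop : (Bool → ℕ) → ℕ → Rel ℕ 0ℓ
Hop gap n i j = InRange n j × ∃₂ λ t s → Next gap t s i j

Stack : ∀ {A B : Set} → (ℕ → A → B) → Pred ℕ 0ℓ → Pred A 0ℓ → Pred B 0ℓ
Stack at I V w = ∃₂ λ i v → I i × V v × w ≡ at i v

link-unmap : ∀ {A B : Set} {f : A → B} {a b x y} → (∀ {u v} → f u ≡ f v → u ≡ v) →
  Link (f a) (f b) (f x) (f y) → Link a b x y
link-unmap inj (inj₁ (e , e′)) = inj₁ (inj e , inj e′)
link-unmap inj (inj₂ (e , e′)) = inj₂ (inj e , inj e′)

-- The slot (t , s) of a copy in layer i is the edge sacrificed to join that copy to
-- its neighbour at distance gap t in direction s. Every joint has its own slot, so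
-- copies can be joined along an arbitrary spanning tree of the layers.
module Stacking
  {A B : Set} {V : Pred A 0ℓ} {E : Rel A 0ℓ} {F : Rel B 0ℓ} (F-sym : Symmetric F)
  (gap : Bool → ℕ) (n : ℕ)
  (at : ℕ → A → B) (at-injective : ∀ {i j a b} → at i a ≡ at j b → i ≡ j × a ≡ b)
  (at-adjacent : ∀ i {a b} → E a b → F (at i a) (at i b))
  {x y : A} {p : Path x y} (C : IsCycle V E p)
  (slotˡ slotʳ : Bool → Bool → A)
  (slot-edge : ∀ t s → Edge (slotˡ t s) (slotʳ t s) p)
  (slot-injective : ∀ {t s t′ s′} → Link (slotˡ t s) (slotʳ t s) (slotˡ t′ s′) (slotʳ t′ s′) → t ≡ t′ × s ≡ s′)
  (crossˡ : ∀ t s {i j} → Next gap t s i j → F (at i (slotˡ t s)) (at j (slotˡ t (not s))))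
  (crossʳ : ∀ t s {i j} → Next gap t s i j → F (at i (slotʳ t s)) (at j (slotʳ t (not s))))
  where

  Slot : Bool → Bool → A → A → Set
  Slot t s a b = Link a b (slotˡ t s) (slotʳ t s)

  at-injectiveʳ : ∀ {i a b} → at i a ≡ at i b → a ≡ b
  at-injectiveʳ = proj₂ ∘ at-injective

  -- The invariant is `retained`: an edge of a copy can have been lost only if it is a slot facing a
  -- layer of `S`. A slot facing a layer outside `S` is therefore still available.
  record Merged (S : List ℕ) : Set where
    field
      {first last} : B
      path         : Path first last
      isCycle      : IsCycle (Stack at (_∈ S) V) F path
      inRange      : ListAll.All (InRange n) S
      retained     : ∀ {i a b} → i ∈ S → Edge a b p →
                     (∀ t s → Slot t s a b → ∀ {j} → j ∈ S → ¬ Next gap t s i j) →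
                     Edge (at i a) (at i b) path

  copy : ∀ i → IsCycle (λ w → ∃ λ v → V v × w ≡ at i v) F (map (at i) p)
  copy i = record
    { long     = subst (_≥ 3)
        (sym (trans (cong length (vertices-map (at i) p)) (length-map (at i) (vertices p)))) (long C)
    ; unique   = subst Unique (sym (vertices-map (at i) p)) (Unique.map⁺ at-injectiveʳ (unique C))
    ; spans    = λ w → mk⇔
        (λ w∈ → let v , v∈ , e = ∈-map⁻ (at i) (subst (w ∈_) (vertices-map (at i) p) w∈) in v , sound C v∈ , e)
        (λ { (v , v∈V , refl) → subst (at i v ∈_) (sym (vertices-map (at i) p)) (∈-map⁺ (at i) (complete C v∈V)) })
    ; adjacent = λ e → at-edge (edge-map⁻ (at i) p e)
    }
    where
    at-edge : ∀ {c d} → (∃₂ λ a b → Edge a b p × c ≡ at i a × d ≡ at i b) → F c d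
    at-edge (_ , _ , e , refl , refl) = at-adjacent i (adjacent C e)

  singleton : ∀ i → InRange n i → Merged (i ∷ [])
  singleton i i∈ = record
    { path     = map (at i) p
    ; isCycle  = isCycle-resp-⇔ (λ w → mk⇔ (λ (v , v∈V , e) → i , v , here refl , v∈V , e)
                   λ { (_ , v , here refl , v∈V , e) → v , v∈V , e }) (copy i)
    ; inRange  = i∈ ∷ []
    ; retained = λ { (here refl) e _ → edge-map⁺ (at i) p e }
    }

  join : ∀ {S t s i j} → Merged S → i ∈ S → j ∉ S → InRange n j → Next gap t s i j → Merged (j ∷ S)
  join {S} {t} {s} {i} {j} M i∈S j∉S j∈range next
    with open-at (M.path) (M.retained i∈S (slot-edge t s) unused)
       | open-at (map (at j) p) (edge-swap (map (at j) p) (edge-map⁺ (at j) p (slot-edge t (not s))))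
    where
    module M = Merged M
    -- This edge is the slot of no other joint, and its own joint leads only to `j`, which is not
    -- yet merged.
    unused : ∀ t′ s′ → Slot t′ s′ (slotˡ t s) (slotʳ t s) → ∀ {k} → k ∈ S → ¬ Next gap t′ s′ i k
    unused t′ s′ l k∈S next′ with slot-injective l
    ... | refl , refl = j∉S (subst (_∈ S) (next-functional gap t s next′ next) k∈S)
  ... | q , q≃ | r , r≃ = record
    { path     = q ⧺ r
    ; isCycle  = isCycle-resp-⇔
        (λ w → mk⇔
          (λ { (inj₁ (k , v , k∈S , v∈)) → k , v , there k∈S , v∈
             ; (inj₂ (v , v∈)) → j , v , here refl , v∈ })
          λ { (_ , v , here refl , v∈) → inj₂ (v , v∈)
            ; (k , v , there k∈S , v∈) → inj₁ (k , v , k∈S , v∈) })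
        (cycle-⧺ q r F-sym (isCycle-resp-≃ q≃ M.isCycle) (isCycle-resp-≃ r≃ (copy j))
          (λ { (k , v , k∈S , _ , refl) (_ , _ , e) → j∉S (subst (_∈ S) (proj₁ (at-injective e)) k∈S) })
          -- The slot in layer `i` was opened from left to right and the opposite slot in layer `j`
          -- from right to left, so right ends meet at the joint and left ends at the closing edge.
          (crossʳ t s next)
          (F-sym (crossˡ t s next)))
    ; inRange  = j∈range ∷ M.inRange
    ; retained = retained
    }
    where
    module M = Merged M
    retained : ∀ {k a b} → k ∈ j ∷ S → Edge a b p →
      (∀ t s → Slot t s a b → ∀ {m} → m ∈ j ∷ S → ¬ Next gap t s k m) → Edge (at k a) (at k b) (q ⧺ r)
    retained {a = a} {b} (here refl) e free with edges⁻ r≃ (edge-map⁺ (at j) p e)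
    -- The only edge lost from the new copy is its slot facing `i`, which `free` rules out; for an
    -- old copy below it is the slot of `i` facing `j`.
    ... | inj₁ l  = ⊥-elim
      (free t (not s) (link-swapʳ (link-unmap at-injectiveʳ l)) (there i∈S) (next-swap gap t s next))
    ... | inj₂ st = inj₂ (step-⧺⁺ q r (inj₂ (inj₂ st)))
    retained {k} {a} {b} (there k∈S) e free
      with edges⁻ q≃ (M.retained k∈S e λ t s l m∈S → free t s l (there m∈S))
    ... | inj₂ st = inj₂ (step-⧺⁺ q r (inj₁ st))
    ... | inj₁ l  with k≡i l
      where
      k≡i : ∀ {c d} → Link (at k a) (at k b) (at i c) (at i d) → k ≡ i
      k≡i (inj₁ (e , _)) = proj₁ (at-injective e)
      k≡i (inj₂ (e , _)) = proj₁ (at-injective e)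
    ...   | refl = ⊥-elim (free t s (link-unmap at-injectiveʳ l) (here refl) next)

  Extension : List ℕ → Pred ℕ 0ℓ → Set
  Extension S I = ∃ λ S′ → Merged S′ × (∀ {i} → i ∈ S → i ∈ S′) × (∀ {i} → I i → i ∈ S′)

  -- Follows the walk and joins each layer met for the first time to its predecessor. Layers already
  -- merged are passed through, so the joints made form a tree.
  reach : ∀ {S i j} → Merged S → i ∈ S → Star (Hop gap n) i j → Extension S (_≡ j)
  reach M i∈S ε = _ , M , id , λ { refl → i∈S }
  reach {S} M i∈S (_◅_ {j = k} (k∈range , t , s , next) hops) with k ∈? S
  ... | yes k∈S = reach M k∈S hops
  ... | no  k∉S with reach (join M i∈S k∉S k∈range next) (here refl) hops
  ...   | S′ , M′ , ⊆S′ , ∈S′ = S′ , M′ , ⊆S′ ∘ there , ∈S′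

  module Rooted (root : ℕ) (root∈range : InRange n root)
    (connected : ∀ {j} → InRange n j → Star (Hop gap n) root j) where

    sweep : ∀ k → k ≤ n → Extension (root ∷ []) (InRange k)
    sweep zero    _   = _ , singleton root root∈range , id , λ { (s≤s _ , ()) }
    sweep (suc k) k<n with sweep k (≤-trans (n≤1+n k) k<n)
    ... | S , M , ⊆S , ∈S with reach M (⊆S (here refl)) (connected (s≤s z≤n , k<n))
    ...   | S′ , M′ , ⊆S′ , ∈S′ = S′ , M′ , ⊆S′ ∘ ⊆S , step
      where
      step : ∀ {i} → InRange (suc k) i → i ∈ S′
      step (1≤i , i≤1+k) with m≤n⇒m<n∨m≡n i≤1+k
      ... | inj₁ i<1+k = ⊆S′ (∈S (1≤i , ≤-pred i<1+k))
      ... | inj₂ i≡1+k = ∈S′ i≡1+k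

    -- The last component preserves the non-slot edges in every layer; the spare pairs of the next
    -- dimension come from there.
    stacked : ∃₂ λ x y → Σ (Path x y) λ q → IsCycle (Stack at (InRange n) V) F q ×
      (∀ {i a b} → InRange n i → Edge a b p → (∀ t s → ¬ Slot t s a b) → Edge (at i a) (at i b) q)
    stacked with sweep n ≤-refl
    ... | S , M , _ , ∈S = _ , _ , M.path
      , isCycle-resp-⇔ (λ w → mk⇔ (map₂ (map₂ (map₁ (ListAll.lookup M.inRange)))) (map₂ (map₂ (map₁ ∈S)))) M.isCycle
      , λ i∈ e free → M.retained (∈S i∈) e λ t s l _ → ⊥-elim (free t s l)
      where module M = Merged M

-- Moves

-- The form to which `count` unfolds on a cons, so that the lemmas on `tick` apply to `count` by
-- computation.
tick : ∀ {A : Set} {P : Pred A 0ℓ} → Decidable P → A → ℕ → ℕ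
tick P? x n = (if does (P? x) then suc else id) n

tick-yes : ∀ {A : Set} {P : Pred A 0ℓ} (P? : Decidable P) x {n} → P x → tick P? x n ≡ suc n
tick-yes P? x px with P? x
... | yes _  = refl
... | no ¬px = ⊥-elim (¬px px)

tick-no : ∀ {A : Set} {P : Pred A 0ℓ} (P? : Decidable P) x {n} → ¬ P x → tick P? x n ≡ n
tick-no P? x ¬px with P? x
... | yes px = ⊥-elim (¬px px)
... | no _   = refl

-- Brings the contribution of an inserted third coordinate to the front, leaving the count of the
-- original vector behind it.
tick-third : ∀ {A : Set} {P : Pred A 0ℓ} (P? : Decidable P) x y z {n} →
  tick P? x (tick P? y (tick P? z n)) ≡ tick P? z (tick P? x (tick P? y n))
tick-third P? x y z with does (P? x) | does (P? y) | does (P? z)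
... | true  | true  | true  = refl
... | true  | true  | false = refl
... | true  | false | true  = refl
... | true  | false | false = refl
... | false | true  | true  = refl
... | false | true  | false = refl
... | false | false | true  = refl
... | false | false | false = refl

neg-sub : ∀ x y → ℤ.- (x ℤ.- y) ≡ y ℤ.- x
neg-sub = solve-∀

is±-sub : ∀ {a} x y → Is± a (x ℤ.- y) → Is± a (y ℤ.- x)
is±-sub x y (inj₁ e) = inj₂ (trans (sym (neg-sub x y)) (cong ℤ.-_ e))
is±-sub x y (inj₂ e) = inj₁ (trans (sym (neg-sub x y)) (trans (cong ℤ.-_ e) (ℤ.neg-involutive _)))

sub-zero : ∀ x y → x ℤ.- y ≡ 0ℤ → y ℤ.- x ≡ 0ℤ
sub-zero x y e = trans (sym (neg-sub x y)) (cong ℤ.-_ e)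

count-sub : ∀ {P : Pred ℤ 0ℓ} (P? : Decidable P) → (∀ x y → P (x ℤ.- y) → P (y ℤ.- x)) →
  ∀ {d} (u v : Vec ℤ d) → count P? (zipWith ℤ._-_ v u) ≡ count P? (zipWith ℤ._-_ u v)
count-sub P? flip []      []      = refl
count-sub P? flip (x ∷ u) (y ∷ v) with P? (y ℤ.- x)
... | yes p = trans (cong suc (count-sub P? flip u v)) (sym (tick-yes P? (x ℤ.- y) (flip y x p)))
... | no ¬p = trans (count-sub P? flip u v) (sym (tick-no P? (x ℤ.- y) (¬p ∘ flip x y)))

adjacent-sym : ∀ {α β d} → Symmetric (Adjacent α β {d})
adjacent-sym {α} {β} {_} {u} {v} m = record
  { zeros = trans (cong (_+ 2) (count-sub (ℤ._≟ 0ℤ) sub-zero v u)) (IsMove.zeros m)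
  ; one-α = trans (count-sub (is±? α) is±-sub v u) (IsMove.one-α m)
  ; one-β = trans (count-sub (is±? β) is±-sub v u) (IsMove.one-β m)
  }

∣is±∣ : ∀ {a x} → Is± a x → ∣ x ∣ ≡ a
∣is±∣         (inj₁ refl) = refl
∣is±∣ {a = a} (inj₂ refl) = ℤ.∣-i∣≡∣i∣ (+ a)

is±-unique : ∀ {a b x} → a ≢ b → Is± a x → ¬ Is± b x
is±-unique a≢b p q = a≢b (trans (sym (∣is±∣ p)) (∣is±∣ q))

is±-nonzero : ∀ {a x} → a > 0 → Is± a x → x ≢ 0ℤ
is±-nonzero (s≤s z≤n) (inj₁ refl) ()
is±-nonzero (s≤s z≤n) (inj₂ refl) ()

-- The part inside a layer of a move whose other nonzero coordinate changes the layer.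
data Axial (a : ℕ) : ∀ {d} → Vec ℤ d → Vec ℤ d → Set where
  here  : ∀ {d x y} {v : Vec ℤ d} → Is± a (y ℤ.- x) → Axial a (x ∷ v) (y ∷ v)
  there : ∀ {d x} {u v : Vec ℤ d} → Axial a u v → Axial a (x ∷ u) (x ∷ v)

axial-sym : ∀ {a d} {u v : Vec ℤ d} → Axial a u v → Axial a v u
axial-sym (here {x = x} {y} e) = here (is±-sub y x e)
axial-sym (there p)            = there (axial-sym p)

sub-self : ∀ x → x ℤ.- x ≡ 0ℤ
sub-self x = ℤ.i≡j⇒i-j≡0 {x} refl

is±-sub-self : ∀ {a} → a > 0 → ∀ x → ¬ Is± a (x ℤ.- x)
is±-sub-self a>0 x p = is±-nonzero a>0 p (sub-self x)

zeros-sub-self : ∀ {d} (v : Vec ℤ d) → count (ℤ._≟ 0ℤ) (zipWith ℤ._-_ v v) ≡ d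
zeros-sub-self []      = refl
zeros-sub-self (x ∷ v) = trans (tick-yes (ℤ._≟ 0ℤ) (x ℤ.- x) (sub-self x)) (cong suc (zeros-sub-self v))

count±-sub-self : ∀ {a d} → a > 0 → ∀ (v : Vec ℤ d) → count (is±? a) (zipWith ℤ._-_ v v) ≡ 0
count±-sub-self         a>0 []      = refl
count±-sub-self {a = a} a>0 (x ∷ v) =
  trans (tick-no (is±? a) (x ℤ.- x) (is±-sub-self a>0 x)) (count±-sub-self a>0 v)

axial-zeros : ∀ {a d} {u v : Vec ℤ d} → a > 0 → Axial a u v →
  suc (count (ℤ._≟ 0ℤ) (zipWith ℤ._-_ v u)) ≡ d
axial-zeros a>0 (here {x = x} {y} {v} e) =
  cong suc (trans (tick-no (ℤ._≟ 0ℤ) (y ℤ.- x) (is±-nonzero a>0 e)) (zeros-sub-self v))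
axial-zeros a>0 (there {x = x} p) =
  cong suc (trans (tick-yes (ℤ._≟ 0ℤ) (x ℤ.- x) (sub-self x)) (axial-zeros a>0 p))

axial-count : ∀ {a d} {u v : Vec ℤ d} → a > 0 → Axial a u v → count (is±? a) (zipWith ℤ._-_ v u) ≡ 1
axial-count {a} a>0 (here {x = x} {y} {v} e) =
  trans (tick-yes (is±? a) (y ℤ.- x) e) (cong suc (count±-sub-self a>0 v))
axial-count {a} a>0 (there {x = x} p) =
  trans (tick-no (is±? a) (x ℤ.- x) (is±-sub-self a>0 x)) (axial-count a>0 p)

axial-count-other : ∀ {a b d} {u v : Vec ℤ d} → b > 0 → a ≢ b → Axial a u v →
  count (is±? b) (zipWith ℤ._-_ v u) ≡ 0
axial-count-other {b = b} b>0 a≢b (here {x = x} {y} {v} e) =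
  trans (tick-no (is±? b) (y ℤ.- x) (is±-unique a≢b e)) (count±-sub-self b>0 v)
axial-count-other {b = b} b>0 a≢b (there {x = x} p) =
  trans (tick-no (is±? b) (x ℤ.- x) (is±-sub-self b>0 x)) (axial-count-other b>0 a≢b p)

-- The new coordinate comes third, so that the planar board n₁ × n₂ stays in front.
insert : ∀ {m} → ℤ → Vec ℤ (2 + m) → Vec ℤ (3 + m)
insert z (x ∷ y ∷ v) = x ∷ y ∷ z ∷ v

insert-injective : ∀ {m z z′} {u v : Vec ℤ (2 + m)} → insert z u ≡ insert z′ v → z ≡ z′ × u ≡ v
insert-injective {u = _ ∷ _ ∷ _} {_ ∷ _ ∷ _} refl = refl , refl

insert-axial : ∀ {m a z} {u v : Vec ℤ (2 + m)} → Axial a u v → Axial a (insert z u) (insert z v)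
insert-axial {u = _ ∷ _ ∷ _} {_ ∷ _ ∷ _} (here e)          = here e
insert-axial {u = _ ∷ _ ∷ _} {_ ∷ _ ∷ _} (there (here e))  = there (here e)
insert-axial {u = _ ∷ _ ∷ _} {_ ∷ _ ∷ _} (there (there p)) = there (there (there p))

insert-adjacent : ∀ {α β m} → α > 0 → β > 0 → ∀ z {u v : Vec ℤ (2 + m)} →
  Adjacent α β u v → Adjacent α β (insert z u) (insert z v)
insert-adjacent {α} {β} α>0 β>0 z {x ∷ y ∷ _} {x′ ∷ y′ ∷ _} m = record
  { zeros = trans (cong (_+ 2) (trans (tick-third (ℤ._≟ 0ℤ) dx dy dz) (tick-yes (ℤ._≟ 0ℤ) dz (sub-self z))))
                  (cong suc (IsMove.zeros m))
  ; one-α = trans (trans (tick-third (is±? α) dx dy dz) (tick-no (is±? α) dz (is±-sub-self α>0 z))) (IsMove.one-α m)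
  ; one-β = trans (trans (tick-third (is±? β) dx dy dz) (tick-no (is±? β) dz (is±-sub-self β>0 z))) (IsMove.one-β m)
  }
  where
  dx = x′ ℤ.- x
  dy = y′ ℤ.- y
  dz = z ℤ.- z

insert-cross : ∀ {a b m z z′} {u v : Vec ℤ (2 + m)} → a > 0 → b > 0 → a ≢ b →
  Is± a (z′ ℤ.- z) → Axial b u v → Adjacent a b (insert z u) (insert z′ v)
insert-cross {a} {b} {z = z} {z′} {x ∷ y ∷ _} {x′ ∷ y′ ∷ _} a>0 b>0 a≢b e p = record
  { zeros = trans (cong (_+ 2) (trans (tick-third (ℤ._≟ 0ℤ) dx dy dz) (tick-no (ℤ._≟ 0ℤ) dz (is±-nonzero a>0 e))))
                  (trans (+-comm _ 2) (cong suc (axial-zeros b>0 p)))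
  ; one-α = trans (trans (tick-third (is±? a) dx dy dz) (tick-yes (is±? a) dz e))
                  (cong suc (axial-count-other a>0 (a≢b ∘ sym) p))
  ; one-β = trans (trans (tick-third (is±? b) dx dy dz) (tick-no (is±? b) dz (is±-unique a≢b e)))
                  (axial-count b>0 p)
  }
  where
  dx = x′ ℤ.- x
  dy = y′ ℤ.- y
  dz = z′ ℤ.- z

adjacent-comm : ∀ {α β d} {u v : Vec ℤ d} → Adjacent α β u v → Adjacent β α u v
adjacent-comm m = record { zeros = IsMove.zeros m ; one-α = IsMove.one-β m ; one-β = IsMove.one-α m }

count-pair : ∀ {A : Set} {P : Pred A 0ℓ} (P? : Decidable P) x y → count P? (x ∷ y ∷ []) ≡ 1 →
  (P x × ¬ P y) ⊎ (¬ P x × P y)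
count-pair P? x y e with P? x | P? y
... | yes p | no ¬q = inj₁ (p , ¬q)
... | no ¬p | yes q = inj₂ (¬p , q)
count-pair P? x y () | yes _ | yes _
count-pair P? x y () | no _  | no _

planar-move : ∀ {α β x y} → α ≢ β → IsMove α β (x ∷ y ∷ []) →
  (Is± α x × Is± β y) ⊎ (Is± β x × Is± α y)
planar-move {x = x} {y} α≢β m with count-pair (is±? _) x y (IsMove.one-α m) | count-pair (is±? _) x y (IsMove.one-β m)
... | inj₁ (αx , _) | inj₂ (_ , βy) = inj₁ (αx , βy)
... | inj₂ (_ , αy) | inj₁ (βx , _) = inj₂ (βx , αy)
... | inj₁ (αx , _) | inj₁ (βx , _) = ⊥-elim (is±-unique α≢β αx βx)
... | inj₂ (_ , αy) | inj₂ (_ , βy) = ⊥-elim (is±-unique α≢β αy βy)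

-- Connectedness of the layers

-- The differences of `h` along the path telescope.
walk-∣ : ∀ {A : Set} (h : A → ℤ) {k x y} (p : Path x y) →
  (∀ {a b} → Step a b p → k ℤ∣.∣ h a ℤ.- h b) → ∀ {v} → v ∈ vertices p → k ℤ∣.∣ h v ℤ.- h x
walk-∣ h {k} {x} [ _ ] f (here refl) = subst (k ℤ∣.∣_) (sym (sub-self (h x))) (ℤ∣.divides 0ℤ refl)
walk-∣ h {k} {x} (_ ∷ p) f (here refl) = subst (k ℤ∣.∣_) (sym (sub-self (h x))) (ℤ∣.divides 0ℤ refl)
walk-∣ h {k} {x} (_∷_ _ {y} p) f {v} (there v∈) = subst (k ℤ∣.∣_) (ℤ.+-minus-telescope (h v) (h y) (h x))
  (ℤ∣.∣m∣n⇒∣m+n (walk-∣ h p (f ∘ inj₂) v∈) (f (inj₁ (inj₂ (refl , refl)))))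

is±-∣ : ∀ {k a x} → k ℕ∣.∣ a → Is± a x → + k ℤ∣.∣ x
is±-∣ k∣a (inj₁ refl) = ℤ∣.∣ᵤ⇒∣ k∣a
is±-∣ k∣a (inj₂ refl) = ℤ∣.∣m⇒∣-m (ℤ∣.∣ᵤ⇒∣ k∣a)

-- A common divisor of `α` and `β` divides every step of `h`, hence the difference of `h` between
-- any two vertices, and that difference is 1 for `u` and `v`.
cycle⇒coprime : ∀ {A : Set} {V : Pred A 0ℓ} {E : Rel A 0ℓ} {x y} {p : Path x y} → IsCycle V E p →
  ∀ {α β} (h : A → ℤ) → (∀ {a b} → E a b → Is± α (h a ℤ.- h b) ⊎ Is± β (h a ℤ.- h b)) →
  ∀ {u v} → V u → V v → h v ℤ.- h u ≡ 1ℤ → Coprime α β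
cycle⇒coprime {x = x} {p = p} C h steps {u} {v} u∈ v∈ diff {k} (k∣α , k∣β) =
  ℕ∣.∣1⇒≡1 (ℤ∣.∣⇒∣ᵤ (subst (+ k ℤ∣.∣_) (trans (telescope (h v) (h u) (h x)) diff)
    (ℤ∣.∣m∣n⇒∣m-n (walk-∣ h p divides (complete C v∈)) (walk-∣ h p divides (complete C u∈)))))
  where
  telescope : ∀ a b c → (a ℤ.- c) ℤ.- (b ℤ.- c) ≡ a ℤ.- b
  telescope = solve-∀
  divides : ∀ {a b} → Step a b p → + k ℤ∣.∣ h a ℤ.- h b
  divides s with steps (adjacent C (inj₂ s))
  ... | inj₁ e = is±-∣ k∣α e
  ... | inj₂ e = is±-∣ k∣β e

-- Solves `k * a ≡ x` modulo `N` by scaling a Bézout identity; multiples of `N` on both sides avoid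
-- subtraction.
multiple-≡ : ∀ {a N} → Coprime a N → N > 0 → ∀ x → ∃ λ k → ∃₂ λ q r → k * a + q * N ≡ x + r * N
multiple-≡ {a} {suc M} c (s≤s z≤n) x with coprime-Bézout c
... | Bézout.+- k q e = x * k , 0 , x * q , trans (trans (h₁ x k a) (cong (x *_) (sym e))) (h₂ x q (suc M))
  where
  h₁ : ∀ x k a → x * k * a + 0 ≡ x * (k * a)
  h₁ = ℕ-Ring.solve-∀
  h₂ : ∀ x q N → x * (1 + q * N) ≡ x + x * q * N
  h₂ = ℕ-Ring.solve-∀
-- Here `k * a` is -1 modulo `N`, and the factor `M`, also -1 modulo `N`, corrects the sign.
... | Bézout.-+ k q e = x * M * k , x , x * M * q , trans (h₁ x M k a) (trans (cong (λ n → x * M * n + x) e) (h₂ x M q))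
  where
  h₁ : ∀ x M k a → x * M * k * a + x * suc M ≡ x * M * (1 + k * a) + x
  h₁ = ℕ-Ring.solve-∀
  h₂ : ∀ x M q → x * M * (q * suc M) + x ≡ x + x * M * q * suc M
  h₂ = ℕ-Ring.solve-∀

residue-unique : ∀ {N q q′ r r′} → r < N → r′ < N → r + q * N ≡ r′ + q′ * N → r ≡ r′
residue-unique {N@(suc _)} {q} {q′} {r} {r′} r< r′< e =
  trans (sym (m<n⇒m%n≡m r<)) (trans (sym ([m+kn]%n≡m%n r q N))
    (trans (cong (_% N) e) (trans ([m+kn]%n≡m%n r′ q′ N) (m<n⇒m%n≡m r′<))))

module _ (gap : Bool → ℕ) (α>0 : gap true > 0) (β>0 : gap false > 0)
  (coprime : Coprime (gap true) (gap false))
  {n : ℕ} (n≥ : n ≥ gap true + gap false ∸ 1) where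

  private
    α = gap true
    β = gap false
    N = α + β

    -- The bound on `n` says exactly that every nonzero residue modulo `α + β` is a layer.
    <N⇒≤n : ∀ {r} → r < N → r ≤ n
    <N⇒≤n r<N = ≤-trans (<⇒≤pred r<N) n≥

    α<N : α < N
    α<N = m<m+n α β>0

  root∈range : InRange n α
  root∈range = α>0 , <N⇒≤n α<N

  -- The residues of α, 2α, 3α, … modulo α + β: adding α modulo α + β is a hop by α
  -- upwards or by β downwards, and the walk restarts at α whenever it meets 0.
  residue-walk : ∀ k → ∃₂ λ r q → r < N × k * α ≡ r + q * N × (r ≡ 0 ⊎ Star (Hop gap n) α r)
  residue-walk zero = 0 , 0 , ≤-trans (s≤s z≤n) α<N , refl , inj₁ refl
  residue-walk (suc k) with residue-walk k
  ... | r , q , r<N , e , inj₁ refl = α , q , α<N , cong (_+_ α) e , inj₂ ε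
  ... | r , q , r<N , e , inj₂ hops with r <? β
  ...   | yes r<β = r + α , q , r+α<N , trans (cong (_+_ α) e) (h α r (q * N))
                  , inj₂ (hops ◅◅ ((≤-trans α>0 (m≤n+m α r) , <N⇒≤n r+α<N) , true , true , refl) ◅ ε)
    where
    r+α<N : r + α < N
    r+α<N = subst (_< N) (+-comm α r) (+-monoʳ-< α r<β)
    h : ∀ a r x → a + (r + x) ≡ r + a + x
    h = ℕ-Ring.solve-∀
  -- Adding `α` now reaches or passes `N`, and `r + α - N` is `r - β`.
  ...   | no r≮β = r ∸ β , suc q , r′<N , e′ , last
    where
    r-split : r ≡ r ∸ β + β
    r-split = sym (m∸n+n≡m (≮⇒≥ r≮β))
    r′<N : r ∸ β < N
    r′<N = ≤-<-trans (m∸n≤m r β) r<N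
    h : ∀ a b r x → a + (r + b + x) ≡ r + (a + b + x)
    h = ℕ-Ring.solve-∀
    e′ : α + k * α ≡ r ∸ β + suc q * N
    e′ = trans (cong (_+_ α) (trans e (cong (_+ q * N) r-split))) (h α β (r ∸ β) (q * N))
    last : r ∸ β ≡ 0 ⊎ Star (Hop gap n) α (r ∸ β)
    last with r ∸ β ≟ 0
    ... | yes z = inj₁ z
    ... | no ¬z = inj₂ (hops ◅◅ ((n≢0⇒n>0 ¬z , <N⇒≤n r′<N) , false , false , r-split) ◅ ε)

  -- Below `α + β`, the layer `x` is the residue of some multiple of `α`, because `α` is coprime to
  -- `α + β`, and `residue-walk` ends there. Higher layers are reached from `x ∸ α`.
  layers-connected : ∀ {x} → InRange n x → Star (Hop gap n) α x
  layers-connected {x} = <-rec (λ x → InRange n x → Star (Hop gap n) α x) step x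
    where
    step : ∀ x → (∀ {y} → y < x → InRange n y → Star (Hop gap n) α y) → InRange n x → Star (Hop gap n) α x
    step x rec (1≤x , x≤n) with x <? N
    ... | no x≮N = rec y<x (m<n⇒0<n∸m α<x , ≤-trans (m∸n≤m x α) x≤n)
                     ◅◅ ((1≤x , x≤n) , true , true , sym (m∸n+n≡m (<⇒≤ α<x))) ◅ ε
      where
      α<x : α < x
      α<x = <-≤-trans α<N (≮⇒≥ x≮N)
      y<x : x ∸ α < x
      y<x = ∸-monoʳ-< α>0 (<⇒≤ α<x)
    ... | yes x<N with multiple-≡ {α} {N} coprime-N (≤-<-trans z≤n α<N) x
      where
      coprime-N : Coprime α N
      coprime-N = Coprime.sym (coprime-+ (Coprime.sym coprime))
    ...   | k , q , q′ , e with residue-walk k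
    ...     | r , s , r<N , e′ , walk
      with residue-unique {q = s + q} {q′} r<N x<N (trans (trans (h r s q N) (cong (_+ q * N) (sym e′))) e)
      where
      h : ∀ r s q N → r + (s + q) * N ≡ r + s * N + q * N
      h = ℕ-Ring.solve-∀
    ...       | refl with walk
    ...         | inj₂ hops = hops
    ...         | inj₁ refl with 1≤x
    ...           | ()

-- The corners of the planar board

-- The coordinate at signed distance k from the lower or upper end of 1, …, n.
ruler : Bool → ℕ → ℤ → ℤ
ruler true  n k = 1ℤ ℤ.+ k
ruler false n k = + n ℤ.- k

OnAxis : ℕ → Pred ℤ 0ℓ
OnAxis n x = (1ℤ ℤ.≤ x) × (x ℤ.≤ + n)

ruler-on : ∀ b {n k} → k < n → OnAxis n (ruler b n (+ k))
ruler-on true  k<n = +≤+ (s≤s z≤n) , +≤+ k<n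
ruler-on false {n} {k} k<n = subst (OnAxis n) (sym (trans (ℤ.[+m]-[+n]≡m⊖n n k) (ℤ.⊖-≥ (<⇒≤ k<n))))
  (+≤+ (m<n⇒0<n∸m k<n) , +≤+ (m∸n≤m n k))

ruler-off : ∀ b {n a} → a > 0 → ¬ OnAxis n (ruler b n (0ℤ ℤ.- + a))
ruler-off true  {a = suc zero}    _ (+≤+ () , _)
ruler-off true  {a = suc (suc _)} _ (() , _)
ruler-off false {n} {suc a} _ (_ , +≤+ le) = m+1+n≰m n le

unsub : ∀ {x c d} → x ℤ.- c ≡ d → x ≡ d ℤ.+ c
unsub {x} {c} refl = h x c
  where
  h : ∀ x c → x ≡ x ℤ.- c ℤ.+ c
  h = solve-∀

ruler-move : ∀ b n k {a x} → Is± a (x ℤ.- ruler b n k) →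
  x ≡ ruler b n (k ℤ.+ + a) ⊎ x ≡ ruler b n (k ℤ.- + a)
ruler-move true  n k {a} (inj₁ e) = inj₁ (trans (unsub e) (h (+ a) k))
  where
  h : ∀ a k → a ℤ.+ (1ℤ ℤ.+ k) ≡ 1ℤ ℤ.+ (k ℤ.+ a)
  h = solve-∀
ruler-move true  n k {a} (inj₂ e) = inj₂ (trans (unsub e) (h (+ a) k))
  where
  h : ∀ a k → ℤ.- a ℤ.+ (1ℤ ℤ.+ k) ≡ 1ℤ ℤ.+ (k ℤ.- a)
  h = solve-∀
ruler-move false n k {a} (inj₁ e) = inj₂ (trans (unsub e) (h (+ a) (+ n) k))
  where
  h : ∀ a n k → a ℤ.+ (n ℤ.- k) ≡ n ℤ.- (k ℤ.- a)
  h = solve-∀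
ruler-move false n k {a} (inj₂ e) = inj₁ (trans (unsub e) (h (+ a) (+ n) k))
  where
  h : ∀ a n k → ℤ.- a ℤ.+ (n ℤ.- k) ≡ n ℤ.- (k ℤ.+ a)
  h = solve-∀

ruler-shift : ∀ b n {k l a} → l ℤ.- k ≡ + a → Is± a (ruler b n l ℤ.- ruler b n k)
ruler-shift true  n {k} {l} e = inj₁ (trans (h l k) e)
  where
  h : ∀ l k → 1ℤ ℤ.+ l ℤ.- (1ℤ ℤ.+ k) ≡ l ℤ.- k
  h = solve-∀
ruler-shift false n {k} {l} e = inj₂ (trans (h (+ n) l k) (cong ℤ.-_ e))
  where
  h : ∀ n l k → n ℤ.- l ℤ.- (n ℤ.- k) ≡ ℤ.- (l ℤ.- k)
  h = solve-∀

ruler-injective : ∀ b n {k l} → ruler b n k ≡ ruler b n l → k ≡ l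
ruler-injective true  n e = ℤ-Group.∙-cancelˡ 1ℤ _ _ e
ruler-injective false n e = ℤ.neg-injective (ℤ-Group.∙-cancelˡ (+ n) _ _ e)

opposite-ends : ∀ {n k l} → k + l + 1 < n → 1ℤ ℤ.+ + k ≢ + n ℤ.- + l
opposite-ends {n} {k} {l} lt e = <⇒≢ lt (trans (h₂ k l) (ℤ.+-injective (trans (cong (ℤ._+ + l) e) (h (+ n) (+ l)))))
  where
  h : ∀ n l → n ℤ.- l ℤ.+ l ≡ n
  h = solve-∀
  h₂ : ∀ k l → k + l + 1 ≡ 1 + k + l
  h₂ = ℕ-Ring.solve-∀

-- Measured from opposite ends, the positions coincide only if `k + l + 1 ≡ n`. The bound may assume
-- `b ≢ b′`: the depths used later are guaranteed to sum to at most `α + β` only at opposite ends.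
ruler-side : ∀ b b′ {n k l} → (b ≢ b′ → k + l + 1 < n) → ruler b n (+ k) ≡ ruler b′ n (+ l) → b ≡ b′
ruler-side true  true  lt e = refl
ruler-side false false lt e = refl
ruler-side true  false lt e = ⊥-elim (opposite-ends (lt λ ()) e)
ruler-side false true  {n} {k} {l} lt e =
  ⊥-elim (opposite-ends (subst (λ m → m + 1 < n) (+-comm k l) (lt λ ())) (sym e))

module Leaper (α β : ℕ) (β>0 : β > 0) (α>β : α > β) where

  -- Joints of type t link layers at distance gap t through shifts by gap (not t)
  -- inside the layers.
  gap : Bool → ℕ
  gap true  = α
  gap false = β

  α>0 : α > 0
  α>0 = <-trans β>0 α>β

  gap>0 : ∀ t → gap t > 0
  gap>0 true  = α>0
  gap>0 false = β>0

  gap≤α : ∀ t → gap t ≤ α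
  gap≤α true  = ≤-refl
  gap≤α false = <⇒≤ α>β

  α≢β : α ≢ β
  α≢β = <⇒≢ α>β ∘ sym

  planar : ∀ {x y} → IsMove α β (x ∷ y ∷ []) → ∃ λ t → Is± (gap t) x × Is± (gap (not t)) y
  planar m with planar-move α≢β m
  ... | inj₁ e = true , e
  ... | inj₂ e = false , e

  -- Eight edges: `w` chooses between two copies of each pair, `t` is the type of joint, and `s` is
  -- the edge within the pair. `extend` spends the copy `true` and keeps the copy `false`.
  record Gadgets {d} (ns : Vec ℕ d) : Set where
    field
      {first last} : Vec ℤ d
      path         : Path first last
      isCycle      : IsCycle (Chessboard ns) (Adjacent α β) path
      endˡ endʳ    : (w t s : Bool) → Vec ℤ d
      edge         : ∀ w t s → Edge (endˡ w t s) (endʳ w t s) path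
      distinct     : ∀ {w t s w′ t′ s′} → Link (endˡ w t s) (endʳ w t s) (endˡ w′ t′ s′) (endʳ w′ t′ s′) →
                     w ≡ w′ × t ≡ t′ × s ≡ s′
      axialˡ       : ∀ w t → Axial (gap (not t)) (endˡ w t true) (endˡ w t false)
      axialʳ       : ∀ w t → Axial (gap (not t)) (endʳ w t true) (endʳ w t false)

  module Planar (n₁ n₂ : ℕ) (n₁≥ : n₁ ≥ 2 * α + 1) (n₂≥ : n₂ ≥ 2 * α + 1)
    {x y : Vec ℤ 2} {p : Path x y} (C : IsCycle (Chessboard (n₁ ∷ n₂ ∷ [])) (Adjacent α β) p) where

    α+β+1< : ∀ {n} → n ≥ 2 * α + 1 → α + β + 1 < n
    α+β+1< n≥ = <-≤-trans (+-monoˡ-< 1 (subst (α + β <_) (cong (_+_ α) (sym (+-identityʳ α))) (+-monoʳ-< α α>β))) n≥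

    α+1< : ∀ {n} → n ≥ 2 * α + 1 → α + 1 < n
    α+1< n≥ = ≤-<-trans (+-monoˡ-≤ 1 (m≤m+n α β)) (α+β+1< n≥)

    gap< : ∀ t {n} → n ≥ 2 * α + 1 → gap t < n
    gap< t n≥ = ≤-<-trans (≤-trans (gap≤α t) (m≤m+n α 1)) (α+1< n≥)

    0<n : ∀ {n} → n ≥ 2 * α + 1 → 0 < n
    0<n n≥ = ≤-<-trans z≤n (α+1< n≥)

    onBoard : ∀ {x y} → OnAxis n₁ x → OnAxis n₂ y → Chessboard (n₁ ∷ n₂ ∷ []) (x ∷ y ∷ [])
    onBoard x∈ y∈ = x∈ ∷ y∈ ∷ []

    coprime : Coprime α β
    coprime = cycle⇒coprime C head steps
      -- The cells (1 , 1) and (2 , 1).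
      (onBoard (ruler-on true (0<n n₁≥)) (ruler-on true (0<n n₂≥)))
      (onBoard (ruler-on true 1<n₁) (ruler-on true (0<n n₂≥)))
      refl
      where
      1<n₁ : 1 < n₁
      1<n₁ = ≤-<-trans (m≤n+m 1 α) (α+1< n₁≥)
      steps : ∀ {a b} → Adjacent α β a b → Is± α (head a ℤ.- head b) ⊎ Is± β (head a ℤ.- head b)
      steps {x ∷ _ ∷ []} {x′ ∷ _ ∷ []} m with planar m
      ... | true  , e , _ = inj₁ (is±-sub x′ x e)
      ... | false , e , _ = inj₂ (is±-sub x′ x e)

    -- `w` picks the side of the board. `t` picks both the corner on that side and the type of joint
    -- built there, so each side supplies one pair of each type.
    module AtSide (w t : Bool) where

      f g : ℤ → ℤ
      f = ruler w n₁
      g = ruler t n₂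

      neighbour : ∀ k {v} → Edge (f 0ℤ ∷ g k ∷ []) v p →
        ∃₂ λ t l → v ≡ f (+ gap t) ∷ g l ∷ [] × OnAxis n₂ (g l) × (l ≡ k ℤ.+ + gap (not t) ⊎ l ≡ k ℤ.- + gap (not t))
      neighbour k {x ∷ y ∷ []} e with sound C (edge⇒∈ʳ p e) | planar (adjacent C e)
      ... | x∈ ∷ y∈ ∷ [] | t′ , ex , ey with ruler-move w n₁ 0ℤ {x = x} ex | ruler-move t n₂ k {x = y} ey
      ...   | inj₂ refl | _         = ⊥-elim (ruler-off w (gap>0 t′) x∈)
      ...   | inj₁ refl | inj₁ refl = t′ , _ , refl , y∈ , inj₁ refl
      ...   | inj₁ refl | inj₂ refl = t′ , _ , refl , y∈ , inj₂ refl

      Forced : Bool → Set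
      Forced t = Edge (f 0ℤ ∷ g 0ℤ ∷ []) (f (+ gap t) ∷ g (+ gap (not t)) ∷ []) p

      corner-neighbour : ∀ {v} → Edge (f 0ℤ ∷ g 0ℤ ∷ []) v p →
        ∃ λ t → v ≡ f (+ gap t) ∷ g (+ gap (not t)) ∷ []
      corner-neighbour e with neighbour 0ℤ e
      ... | t , _ , refl , y∈ , inj₁ refl = t , refl
      ... | t′ , _ , refl , y∈ , inj₂ refl = ⊥-elim (ruler-off t (gap>0 (not t′)) y∈)

      -- Only two moves from the corner stay on the board, and the cycle needs two distinct
      -- neighbours.
      corner : ∀ t → Forced t
      corner with two-neighbours C (onBoard (ruler-on w (0<n n₁≥)) (ruler-on t (0<n n₂≥)))
      ... | a , b , a≢b , ea , eb with corner-neighbour ea | corner-neighbour eb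
      ...   | true  , refl | true  , refl = ⊥-elim (a≢b refl)
      ...   | false , refl | false , refl = ⊥-elim (a≢b refl)
      ...   | true  , refl | false , refl = λ { true → ea ; false → eb }
      ...   | false , refl | true  , refl = λ { true → eb ; false → ea }

      -- The far end of the forced corner edge of type `t′`, shifted along the side by the distance
      -- `gap (not t)` that separates the near ends.
      Shifted : Pred (Vec ℤ 2) 0ℓ
      Shifted v = ∃₂ λ t′ l → v ≡ f (+ gap t′) ∷ g l ∷ [] × Is± (gap (not t)) (g l ℤ.- g (+ gap (not t′)))

      unshifted : Vec ℤ 2
      unshifted = f (+ gap (not t)) ∷ g (+ gap (not t) ℤ.- + gap t) ∷ []

      -- A move away from the corner is parallel to a forced edge. A move towards it of type `t`
      -- ends at `l = 0`, again at distance `gap (not t)` from the forced end; only the type `not t`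
      -- fails.
      shifted? : ∀ {v} → Edge (f 0ℤ ∷ g (+ gap (not t)) ∷ []) v p → Shifted v ⊎ v ≡ unshifted
      shifted? e with neighbour (+ gap (not t)) e
      ... | t′ , _ , refl , _ , inj₁ refl = inj₁ (t′ , _ , refl , ruler-shift t n₂ (h (+ gap (not t)) (+ gap (not t′))))
        where
        h : ∀ a c → a ℤ.+ c ℤ.- c ≡ a
        h = solve-∀
      ... | t′ , _ , refl , _ , inj₂ refl with t′ ≟ᵇ t
      ...   | yes refl = inj₁ (t , _ , refl , is±-sub (g (+ gap (not t))) _ (ruler-shift t n₂ (h (+ gap (not t)))))
        where
        h : ∀ a → a ℤ.- (a ℤ.- a) ≡ a
        h = solve-∀
      ...   | no t′≢t with ¬-not t′≢t
      ...     | refl = inj₂ (cong (λ t″ → f (+ gap (not t)) ∷ g (+ gap (not t) ℤ.- + gap t″) ∷ []) (not-involutive t))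

      -- Of two distinct neighbours at most one is the exceptional cell.
      opposed : Σ (Vec ℤ 2) λ v → Shifted v × Edge (f 0ℤ ∷ g (+ gap (not t)) ∷ []) v p
      opposed with two-neighbours C (onBoard (ruler-on w (0<n n₁≥)) (ruler-on t (gap< (not t) n₂≥)))
      ... | a , b , a≢b , ea , eb with shifted? ea | shifted? eb
      ...   | inj₁ sa   | _         = a , sa , ea
      ...   | inj₂ _    | inj₁ sb   = b , sb , eb
      ...   | inj₂ refl | inj₂ refl = ⊥-elim (a≢b refl)

      shiftedEnd : Vec ℤ 2
      shiftedEnd = proj₁ opposed

      -- Which of the two forced corner edges is the partner of the edge found in `opposed`.
      side : Bool
      side = proj₁ (proj₁ (proj₂ opposed))

      endʳ : Bool → Vec ℤ 2
      endʳ true  = f (+ gap side) ∷ g (+ gap (not side)) ∷ []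
      endʳ false = shiftedEnd

      depth : Bool → ℕ
      depth true  = 0
      depth false = gap (not t)

      endˡ : Bool → Vec ℤ 2
      endˡ s = f 0ℤ ∷ g (+ depth s) ∷ []

      edge : ∀ s → Edge (endˡ s) (endʳ s) p
      edge true  = corner side
      edge false = proj₂ (proj₂ opposed)

      endʳ-head : ∀ s → head (endʳ s) ≡ f (+ gap side)
      endʳ-head true  = refl
      endʳ-head false with opposed
      ... | _ , (_ , _ , refl , _) , _ = refl

      axialˡ : Axial (gap (not t)) (endˡ true) (endˡ false)
      axialˡ = there (here (ruler-shift t n₂ (ℤ.+-identityʳ _)))

      axialʳ : Axial (gap (not t)) (endʳ true) (endʳ false)
      axialʳ with opposed
      ... | _ , (_ , _ , refl , e) , _ = there (here e)

      depth≤ : ∀ s → depth s ≤ gap (not t)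
      depth≤ true  = z≤n
      depth≤ false = ≤-refl

      depth-injective : ∀ s s′ → depth s ≡ depth s′ → s ≡ s′
      depth-injective true  true  e = refl
      depth-injective false false e = refl
      depth-injective true  false e = ⊥-elim (<⇒≢ (gap>0 (not t)) e)
      depth-injective false true  e = ⊥-elim (<⇒≢ (gap>0 (not t)) (sym e))

    open AtSide

    -- The first coordinate reveals `w`; the second reveals `t`, since `α + β + 1 < n₂`, and then
    -- the depth.
    endˡ-injective : ∀ {w t s w′ t′ s′} → endˡ w t s ≡ endˡ w′ t′ s′ → w ≡ w′ × t ≡ t′ × s ≡ s′
    endˡ-injective {w} {t} {s} {w′} {t′} {s′} e
      with ruler-side w w′ {k = 0} {l = 0} (λ _ → ≤-<-trans (m≤n+m 1 α) (α+1< n₁≥)) (cong head e)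
         | ruler-side t t′ {k = depth w t s} {l = depth w′ t′ s′} far (cong (head ∘ tail) e)
      where
      gaps : ∀ t t′ → t ≢ t′ → gap (not t) + gap (not t′) ≡ α + β
      gaps true  true  t≢t′ = ⊥-elim (t≢t′ refl)
      gaps false false t≢t′ = ⊥-elim (t≢t′ refl)
      gaps true  false t≢t′ = +-comm β α
      gaps false true  t≢t′ = refl
      far : t ≢ t′ → depth w t s + depth w′ t′ s′ + 1 < n₂
      far t≢t′ = ≤-<-trans
        (+-monoˡ-≤ 1 (≤-trans (+-mono-≤ (depth≤ w t s) (depth≤ w′ t′ s′)) (≤-reflexive (gaps t t′ t≢t′))))
        (α+β+1< n₂≥)
    ... | refl | refl = refl , refl
      , depth-injective w t s s′ (ℤ.+-injective (ruler-injective t n₂ (cong (head ∘ tail) e)))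

    -- Left ends lie on a side of the board; right ends lie at a positive distance of at most `α`
    -- from theirs, too close to reach the opposite side.
    endˡ≢endʳ : ∀ w t s w′ t′ s′ → endˡ w t s ≢ endʳ w′ t′ s′
    endˡ≢endʳ w t s w′ t′ s′ e
      with trans (cong head e) (endʳ-head w′ t′ s′)
    ... | e′ with ruler-side w w′ {k = 0} {l = gap (side w′ t′)}
                    (λ _ → ≤-<-trans (+-monoˡ-≤ 1 (gap≤α (side w′ t′))) (α+1< n₁≥)) e′
    ...   | refl = <⇒≢ (gap>0 (side w′ t′)) (ℤ.+-injective (ruler-injective w n₁ e′))

    gadgets : Gadgets (n₁ ∷ n₂ ∷ [])
    gadgets = record
      { path     = p
      ; isCycle  = C
      ; endˡ     = endˡ
      ; endʳ     = endʳ
      ; edge     = edge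
      ; distinct = distinct
      ; axialˡ   = axialˡ
      ; axialʳ   = axialʳ
      }
      where
      distinct : ∀ {w t s w′ t′ s′} →
        Link (endˡ w t s) (endʳ w t s) (endˡ w′ t′ s′) (endʳ w′ t′ s′) → w ≡ w′ × t ≡ t′ × s ≡ s′
      distinct {w} {t} {s}                (inj₁ (e , _)) = endˡ-injective {w} {t} {s} e
      distinct {w} {t} {s} {w′} {t′} {s′} (inj₂ (e , _)) = ⊥-elim (endˡ≢endʳ w t s w′ t′ s′ e)

  -- Adding a dimension

  -- The pairs with `w = true` serve as slots. Those with `w = false` survive in every layer, and in
  -- the new gadgets `w` selects one of two layers.
  extend : ∀ {n₁ n₂ m n} {ns : Vec ℕ m} → Coprime α β → n ≥ α + β ∸ 1 →
    Gadgets (n₁ ∷ n₂ ∷ ns) → Gadgets (n₁ ∷ n₂ ∷ n ∷ ns)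
  extend {n₁} {n₂} {m} {n} {ns} coprime n≥ G = record
    { path     = proj₁ (proj₂ (proj₂ stacked))
    ; isCycle  = isCycle-resp-⇔ stack⇔board (proj₁ (proj₂ (proj₂ (proj₂ stacked))))
    ; endˡ     = λ w t s → at (layer w) (G.endˡ false t s)
    ; endʳ     = λ w t s → at (layer w) (G.endʳ false t s)
    ; edge     = λ w t s → proj₂ (proj₂ (proj₂ (proj₂ stacked))) (layer-inRange w) (G.edge false t s)
                   λ t′ s′ l → false≢true (proj₁ (G.distinct l))
    ; distinct = distinct
    ; axialˡ   = λ w t → insert-axial (G.axialˡ false t)
    ; axialʳ   = λ w t → insert-axial (G.axialʳ false t)
    }
    where
    module G = Gadgets G

    at : ℕ → Vec ℤ (2 + m) → Vec ℤ (3 + m)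
    at i = insert (+ i)

    at-injective : ∀ {i j u v} → at i u ≡ at j v → i ≡ j × u ≡ v
    at-injective e = ℤ.+-injective (proj₁ (insert-injective e)) , proj₂ (insert-injective e)

    next-gap : ∀ t s {i j} → Next gap t s i j → Is± (gap t) (+ j ℤ.- + i)
    next-gap t true  {i}     refl = inj₁ (h (+ i) (+ gap t))
      where
      h : ∀ i a → i ℤ.+ a ℤ.- i ≡ a
      h = solve-∀
    next-gap t false {_} {j} refl = inj₂ (h (+ j) (+ gap t))
      where
      h : ∀ j a → j ℤ.- (j ℤ.+ a) ≡ ℤ.- a
      h = solve-∀

    cross : ∀ t s {i j u v} → Next gap t s i j → Axial (gap (not t)) u v → Adjacent α β (at i u) (at j v)
    cross true  s next a = insert-cross α>0 β>0 α≢β (next-gap true s next) a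
    cross false s next a = adjacent-comm (insert-cross β>0 α>0 (α≢β ∘ sym) (next-gap false s next) a)

    slot-axial : ∀ {u : Bool → Vec ℤ (2 + m)} {a} → Axial a (u true) (u false) → ∀ s → Axial a (u s) (u (not s))
    slot-axial a true  = a
    slot-axial a false = axial-sym a

    open Stacking {F = Adjacent α β} (λ {u v} → adjacent-sym {x = u} {v}) gap n at at-injective
      (λ i {u v} → insert-adjacent α>0 β>0 (+ i) {u} {v}) G.isCycle
      (G.endˡ true) (G.endʳ true) (G.edge true) (λ l → proj₂ (G.distinct l))
      (λ t s next → cross t s next (slot-axial {u = G.endˡ true t} (G.axialˡ true t) s))
      (λ t s next → cross t s next (slot-axial {u = G.endʳ true t} (G.axialʳ true t) s))
      using (module Rooted)

    open Rooted α (root∈range gap α>0 β>0 coprime n≥) (layers-connected gap α>0 β>0 coprime n≥)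

    stack⇔board : ∀ w → Stack at (InRange n) (Chessboard (n₁ ∷ n₂ ∷ ns)) w ⇔ Chessboard (n₁ ∷ n₂ ∷ n ∷ ns) w
    stack⇔board w = mk⇔
      (λ { (i , _ , (1≤i , i≤n) , x∈ ∷ y∈ ∷ v∈ , refl) → x∈ ∷ y∈ ∷ (+≤+ 1≤i , +≤+ i≤n) ∷ v∈ })
      λ { (x∈ ∷ y∈ ∷ (+≤+ 1≤i , +≤+ i≤n) ∷ v∈) → _ , _ ∷ _ ∷ _ , (1≤i , i≤n) , x∈ ∷ y∈ ∷ v∈ , refl }

    layer : Bool → ℕ
    layer true  = 1
    layer false = 2

    layer-injective : ∀ w w′ → layer w ≡ layer w′ → w ≡ w′
    layer-injective true  true  _ = refl
    layer-injective false false _ = refl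

    2≤n : 2 ≤ n
    -- `α` exceeds `β ≥ 1`, and `α` is itself a layer.
    2≤n = ≤-trans (≤-trans (s≤s β>0) α>β) (proj₂ (root∈range gap α>0 β>0 coprime n≥))

    layer-inRange : ∀ w → InRange n (layer w)
    layer-inRange true  = s≤s z≤n , ≤-trans (s≤s z≤n) 2≤n
    layer-inRange false = s≤s z≤n , 2≤n

    false≢true : false ≢ true
    false≢true ()

    same-layer : ∀ {i j a b c d} → Link (at i a) (at i b) (at j c) (at j d) → i ≡ j
    same-layer (inj₁ (e , _)) = proj₁ (at-injective e)
    same-layer (inj₂ (e , _)) = proj₁ (at-injective e)

    distinct : ∀ {w t s w′ t′ s′} →
      Link (at (layer w) (G.endˡ false t s)) (at (layer w) (G.endʳ false t s))
           (at (layer w′) (G.endˡ false t′ s′)) (at (layer w′) (G.endʳ false t′ s′)) →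
      w ≡ w′ × t ≡ t′ × s ≡ s′
    distinct {w} {w′ = w′} l with layer-injective w w′ (same-layer l)
    ... | refl = refl , proj₂ (G.distinct (link-unmap {f = at (layer w)} (proj₂ ∘ at-injective) l))

  -- Each new coordinate lands in third place, so the sizes in `ns` are added from the last to the
  -- first.
  gadgets-extend : ∀ {n₁ n₂ m} {ns : Vec ℕ m} → Coprime α β → All (λ n → n ≥ α + β ∸ 1) ns →
    Gadgets (n₁ ∷ n₂ ∷ []) → Gadgets (n₁ ∷ n₂ ∷ ns)
  gadgets-extend c []        G = G
  gadgets-extend c (n≥ ∷ ns≥) G = extend c n≥ (gadgets-extend c ns≥ G)

theorem5p5 : (α β : ℕ) → β > 0 → α > β →
    (m : ℕ) (n₁ n₂ : ℕ) (ns : Vec ℕ m) →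
    n₁ ≥ 2 * α + 1 → n₂ ≥ 2 * α + 1 →
    All (λ n → n ≥ α + β ∸ 1) ns →
    Tour α β (n₁ ∷ n₂ ∷ []) →
    Tour α β (n₁ ∷ n₂ ∷ ns)
theorem5p5 α β β>0 α>β m n₁ n₂ ns n₁≥ n₂≥ ns≥ tour with fromHamiltonian adjacent-sym tour
... | _ , _ , _ , C = toHamiltonian (Gadgets.isCycle (gadgets-extend coprime ns≥ gadgets))
  where
  open Leaper α β β>0 α>β
  open Planar n₁ n₂ n₁≥ n₂≥ C
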